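{- Let $\mathcal{C}\subseteq 2^{[n]}$ be a code and let $d\ge 1$. Then $\mathcal{C}$ is box-convex in $\mathbb{R}^d$ if and only if $\mathcal{C}$ is the intersection product of $d$-many interval codes, i.e. there exist interval codes $\mathcal{C}_1,\ldots,\mathcal{C}_d\subseteq 2^{[n]}$ with $\mathcal{C}=\mathcal{C}_1\sqcap\cdots\sqcap\mathcal{C}_d$.
   Context: Write $[n]=\{1,\ldots,n\}$. A code is a set $\mathcal{C}\subseteq 2^{[n]}$. For an ordered (indexed) collection $\mathcal{U} = \{U_1, \ldots, U_n\}$ of sets in $\mathbb{R}^d$, its code is $$\operatorname{code}(\mathcal{U}) = \{\sigma\subseteq [n] \mid \text{there exists } p\in \mathbb{R}^d \text{ such that for all } i\in[n],\ p\in U_i \text{ if and only if } i\in\sigma\},$$ and $\mathcal{U}$ is called a realization of $\operatorname{code}(\mathcal{U})$. An axis-parallel box (box for short) in $\mathbb{R}^d$ is either the empty set or a product $[a_1,b_1]\times\cdots\times[a_d,b_d]$ of nonempty closed intervals (degenerate intervals $a_i=b_i$ allowed). A code is box-convex in $\mathbb{R}^d$ if it has a realization in $\mathbb{R}^d$ in which every set is a box. An interval code is a code with a realization in $\mathbb{R}^1$ in which every set is a closed bounded interval (i.e. a box in $\mathbb{R}^1$, so the empty set and single points are allowed). The intersection product of two codes $\mathcal{C},\mathcal{D}\subseteq 2^{[n]}$ is $\mathcal{C} \sqcap \mathcal{D} = \{ c_1 \cap c_2 \mid c_1\in \mathcal{C} \text{ and } c_2\in \mathcal{D}\}$; this operation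 is associative. -}

module Defs where

open import Data.Fin.Base using (Fin)
open import Data.Nat.Base using (ℕ)
open import Data.Product.Base using (_×_; ∃; ∃-syntax)
open import Data.Rational.Base using (ℚ; _<_)
open import Data.Sum.Base using (_⊎_)
open import Data.Vec.Functional using (Vector)
open import Function.Bundles using (_⇔_)
open import Level using (0ℓ; suc)
open import Relation.Nullary.Negation.Core using (¬_)
open import Relation.Unary using (Pred; _∈_; _⊆_; _≐_; _∩_; ∅; Satisfiable)

-- Dedekind reals: two-sided located cuts of ℚ.
record ℝ : Set (suc 0ℓ) where
  field
    lower           : Pred ℚ 0ℓ
    upper           : Pred ℚ 0ℓ
    lower-inhabited : Satisfiable lower
    upper-inhabited : Satisfiable upper
    lower-rounded   : ∀ q → q ∈ lower ⇔ (∃[ r ] (q < r × r ∈ lower))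
    upper-rounded   : ∀ q → q ∈ upper ⇔ (∃[ r ] (r < q × r ∈ upper))
    disjoint        : ∀ q → ¬ (q ∈ lower × q ∈ upper)
    located         : ∀ {q r} → q < r → q ∈ lower ⊎ r ∈ upper

open ℝ

infix 4 _≤ᴿ_

_≤ᴿ_ : ℝ → ℝ → Set
x ≤ᴿ y = lower x ⊆ lower y

ℝ^ : ℕ → Set (suc 0ℓ)
ℝ^ d = Vector ℝ d

∏[_,_] : ∀ {d} → ℝ^ d → ℝ^ d → Pred (ℝ^ d) 0ℓ
∏[ a , b ] p = ∀ j → a j ≤ᴿ p j × p j ≤ᴿ b j

IsBox : ∀ {d} → Pred (ℝ^ d) 0ℓ → Set (suc 0ℓ)
IsBox U = U ≐ ∅ ⊎ (∃[ a ] ∃[ b ] ((∀ j → a j ≤ᴿ b j) × U ≐ ∏[ a , b ]))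

-- Subsets of [n] are predicates rather than Boolean vectors, because the
-- order on ℝ is not decidable constructively; equality of subsets is _≐_.
Subset : ℕ → Set (suc 0ℓ)
Subset n = Pred (Fin n) 0ℓ

-- A code is not required to respect _≐_ on subsets, but  code  and  _⊓_
-- below are closed under it, hence so is every code that is _≐_ to one of them.
Code : ℕ → Set (suc (suc 0ℓ))
Code n = Pred (Subset n) (suc 0ℓ)

code : ∀ {n d} → (Fin n → Pred (ℝ^ d) 0ℓ) → Code n
code U σ = ∃[ p ] (∀ i → p ∈ U i ⇔ i ∈ σ)

BoxConvex : ∀ {n} → ℕ → Code n → Set (suc 0ℓ)
BoxConvex {n} d C =
  ∃ λ (U : Fin n → Pred (ℝ^ d) 0ℓ) → (∀ i → IsBox (U i)) × C ≐ code U

IntervalCode : ∀ {n} → Code n → Set (suc 0ℓ)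
IntervalCode = BoxConvex 1

infixr 7 _⊓_

_⊓_ : ∀ {n} → Code n → Code n → Code n
(C ⊓ D) σ = ∃[ c₁ ] ∃[ c₂ ] (c₁ ∈ C × c₂ ∈ D × σ ≐ c₁ ∩ c₂)

{-# OPTIONS --safe #-}
-- A box in ℝ^(1+d) is a box in ℝ¹ times a box in ℝ^d, and the membership
-- pattern of (x , y) in a family of products V i × W i is the intersection of
-- the patterns of x in V and of y in W.  So codes of families of products are
-- intersection products of codes, and splitting off one coordinate at a time
-- turns box-convex codes into products of interval codes and back.
module Submission where

open import Defs
open import Data.Fin.Base using (Fin; zero; suc)
open import Data.Nat.Base using (ℕ; zero; suc)
open import Data.Product.Base using (_×_; ∃; ∃-syntax; _,_; proj₁; proj₂)
open import Data.Sum.Base using (inj₁; inj₂)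
open import Data.Vec.Base using (Vec; foldr₁; []; _∷_)
import Data.Vec.Functional as F
open import Data.Vec.Relation.Unary.All using (All; []; _∷_)
open import Function.Base using (id; const; _∘_)
open import Function.Bundles using (_⇔_; mk⇔; Equivalence)
open import Level using (0ℓ)
open import Relation.Binary.Core using (_Preserves₂_⟶_⟶_)
open import Relation.Binary.Definitions using (_Respects_)
open import Relation.Binary.PropositionalEquality using (_≗_; refl; subst)
open import Relation.Unary using (Pred; _∈_; _⊆_; _≐_; ∅)
open import Relation.Unary.Properties using (≐-refl; ≐-sym; ≐-trans)

open Equivalence using (to; from)

private
  variable
    n d : ℕ

code-cong-⊆ : {U V : Fin n → Pred (ℝ^ d) 0ℓ} → (∀ i → U i ≐ V i) → code U ⊆ code V
code-cong-⊆ U≐V (p , h) = p , λ i → mk⇔ (to (h i) ∘ proj₂ (U≐V i)) (proj₁ (U≐V i) ∘ from (h i))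

code-cong : {U V : Fin n → Pred (ℝ^ d) 0ℓ} → (∀ i → U i ≐ V i) → code U ≐ code V
code-cong U≐V = code-cong-⊆ U≐V , code-cong-⊆ (≐-sym ∘ U≐V)

⊓-cong : _⊓_ {n} Preserves₂ _≐_ ⟶ _≐_ ⟶ _≐_
⊓-cong (C⊆C′ , C′⊆C) (D⊆D′ , D′⊆D) =
  (λ (c , e , c∈ , e∈ , eq) → c , e , C⊆C′ c∈ , D⊆D′ e∈ , eq) ,
  (λ (c , e , c∈ , e∈ , eq) → c , e , C′⊆C c∈ , D′⊆D e∈ , eq)

BoxConvex-resp-≐ : BoxConvex {n} d Respects _≐_
BoxConvex-resp-≐ C≐D (U , box , C≐) = U , box , ≐-trans (≐-sym C≐D) C≐

-- Points are functions, and an arbitrary predicate may tell pointwise equal functions apart. A box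
-- cannot, since it constrains each coordinate separately.
IsBox-resp-≗ : {U : Pred (ℝ^ d) 0ℓ} → IsBox U → U Respects _≗_
IsBox-resp-≗ (inj₁ (U⊆∅ , _)) p≗q p∈U with () ← U⊆∅ p∈U
IsBox-resp-≗ (inj₂ (a , b , _ , U⊆ , ⊆U)) p≗q p∈U =
  ⊆U λ j → subst (λ x → a j ≤ᴿ x × x ≤ᴿ b j) (p≗q j) (U⊆ p∈U j)

infixr 7 _⊠_

_⊠_ : Pred (ℝ^ 1) 0ℓ → Pred (ℝ^ d) 0ℓ → Pred (ℝ^ (suc d)) 0ℓ
(V ⊠ W) p = const (F.head p) ∈ V × F.tail p ∈ W

∏-∷ : (a b : ℝ^ (suc d)) →
  ∏[ a , b ] ≐ ∏[ const (F.head a) , const (F.head b) ] ⊠ ∏[ F.tail a , F.tail b ]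
∏-∷ a b =
  (λ h → (λ _ → h zero) , h ∘ suc) ,
  (λ (h , t) → λ { zero → h zero ; (suc j) → t j })

⊠-isBox : {V : Pred (ℝ^ 1) 0ℓ} {W : Pred (ℝ^ d) 0ℓ} → IsBox V → IsBox W → IsBox (V ⊠ W)
⊠-isBox (inj₁ (V⊆∅ , _)) _ = inj₁ (V⊆∅ ∘ proj₁ , λ ())
⊠-isBox (inj₂ _) (inj₁ (W⊆∅ , _)) = inj₁ (W⊆∅ ∘ proj₂ , λ ())
⊠-isBox (inj₂ (a , b , a≤b , V⊆ , ⊆V)) (inj₂ (a′ , b′ , a′≤b′ , W⊆ , ⊆W)) = inj₂
  ( F.head a F.∷ a′ , F.head b F.∷ b′
  , (λ { zero → a≤b zero ; (suc j) → a′≤b′ j })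
  , (λ (v , w) → λ { zero → V⊆ v zero ; (suc j) → W⊆ w j })
  , (λ h → ⊆V (λ { zero → h zero }) , ⊆W (h ∘ suc)) )

IsBox-split : {U : Pred (ℝ^ (suc d)) 0ℓ} → IsBox U →
  ∃[ V ] ∃[ W ] (IsBox V × IsBox W × U ≐ V ⊠ W)
IsBox-split (inj₁ (U⊆∅ , _)) =
  ∅ , ∅ , inj₁ ≐-refl , inj₁ ≐-refl , (λ u → U⊆∅ u , U⊆∅ u) , λ ()
IsBox-split (inj₂ (a , b , a≤b , U≐)) =
  -- The two `≐-refl` below determine these factors: the boxes spanned by the first and by the
  -- remaining coordinates of the corners.
  _ , _ ,
  inj₂ (const (F.head a) , const (F.head b) , (λ _ → a≤b zero) , ≐-refl) ,
  inj₂ (F.tail a , F.tail b , a≤b ∘ suc , ≐-refl) ,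
  ≐-trans U≐ (∏-∷ a b)

-- The head and the tail of a point vary independently, so every pattern of `V` meets every pattern
-- of `W`.
code-⊠ : {V : Fin n → Pred (ℝ^ 1) 0ℓ} (W : Fin n → Pred (ℝ^ d) 0ℓ) →
  (∀ i → V i Respects _≗_) → code (λ i → V i ⊠ W i) ≐ code V ⊓ code W
code-⊠ {V = V} W resp =
  (λ (p , h) →
    -- The membership predicates themselves serve as the two patterns, so nothing has to be decided.
    (λ i → const (F.head p) ∈ V i) , (λ i → F.tail p ∈ W i) ,
    (_ , λ _ → mk⇔ id id) , (_ , λ _ → mk⇔ id id) ,
    (λ {i} → from (h i)) , (λ {i} → to (h i))) ,
  (λ (_ , _ , (q , f) , (r , g) , σ⊆ , ⊆σ) →
    -- The tail of this point is `r` by definition, but `const (F.head q)` agrees with `q` only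
    -- pointwise; `resp` bridges the gap.
    F.head q F.∷ r , λ i → mk⇔
      (λ (v , w) → ⊆σ (to (f i) (resp i (λ { zero → refl }) v) , to (g i) w))
      (λ i∈σ → resp i (λ { zero → refl }) (from (f i) (proj₁ (σ⊆ i∈σ))) ,
               from (g i) (proj₂ (σ⊆ i∈σ))))

-- The realization of `C` lives on a new first coordinate, that of `D` on the other `d`.
BoxConvex-⊓ : {C D : Code n} → IntervalCode C → BoxConvex d D → BoxConvex (suc d) (C ⊓ D)
BoxConvex-⊓ (V , boxV , C≐) (W , boxW , D≐) =
  (λ i → V i ⊠ W i) ,
  (λ i → ⊠-isBox (boxV i) (boxW i)) ,
  ≐-trans (⊓-cong C≐ D≐) (≐-sym (code-⊠ W (IsBox-resp-≗ ∘ boxV)))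

BoxConvex-split : {C : Code n} → BoxConvex (suc d) C →
  ∃[ C₁ ] ∃[ D ] (IntervalCode C₁ × BoxConvex d D × C ≐ C₁ ⊓ D)
BoxConvex-split {n} {d} (U , box , C≐) =
  code V , code W , (V , boxV , ≐-refl) , (W , boxW , ≐-refl) ,
  ≐-trans C≐ (≐-trans (code-cong U≐) (code-⊠ W (IsBox-resp-≗ ∘ boxV)))
  where
  V : Fin n → Pred (ℝ^ 1) 0ℓ
  V i = proj₁ (IsBox-split (box i))

  W : Fin n → Pred (ℝ^ d) 0ℓ
  W i = proj₁ (proj₂ (IsBox-split (box i)))

  boxV : ∀ i → IsBox (V i)
  boxV i = let _ , _ , v , _ = IsBox-split (box i) in v

  boxW : ∀ i → IsBox (W i)
  boxW i = let _ , _ , _ , w , _ = IsBox-split (box i) in w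

  U≐ : ∀ i → U i ≐ V i ⊠ W i
  U≐ i = let _ , _ , _ , _ , eq = IsBox-split (box i) in eq

factorise : ∀ d {C : Code n} → BoxConvex (suc d) C →
  ∃ λ (Cs : Vec (Code n) (suc d)) → All IntervalCode Cs × C ≐ foldr₁ _⊓_ Cs
-- In dimension one, `C` is itself an interval code and the only factor.
factorise zero {C} bc = C ∷ [] , bc ∷ [] , ≐-refl
factorise (suc d) bc
  with C₁ , D , ic , bcD , C≐ ← BoxConvex-split bc
  -- Exposing the head of `Cs` lets `foldr₁` unfold on `C₁ ∷ Cs`.
  with Cs@(_ ∷ _) , ics , D≐ ← factorise d bcD
  = C₁ ∷ Cs , ic ∷ ics , ≐-trans C≐ (⊓-cong ≐-refl D≐)

foldr₁-⊓-boxConvex : {Cs : Vec (Code n) (suc d)} → All IntervalCode Cs →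
  BoxConvex (suc d) (foldr₁ _⊓_ Cs)
foldr₁-⊓-boxConvex (ic ∷ []) = ic
foldr₁-⊓-boxConvex (ic ∷ ics@(_ ∷ _)) = BoxConvex-⊓ ic (foldr₁-⊓-boxConvex ics)

corollary5 : ∀ (n d : ℕ) (C : Code n) →
    BoxConvex (suc d) C ⇔
    (∃ λ (Cs : Vec (Code n) (suc d)) → All IntervalCode Cs × C ≐ foldr₁ _⊓_ Cs)
corollary5 n d C = mk⇔ (factorise d)
  (λ (_ , ics , C≐) → BoxConvex-resp-≐ (≐-sym C≐) (foldr₁-⊓-boxConvex ics))
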